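{- Let $n\geq 1$. A function $\mathcal{N}:L_n([0,1])\to L_n([0,1])$ is an $n$-dimensional strong fuzzy negation if and only if there exists an $n$-dimensional automorphism $\varphi$ such that $\mathcal{N}=\mathcal{N}_S^{\varphi}$, i.e. $\mathcal{N}(\mathbf{x})=\varphi^{ -1}(\mathcal{N}_S(\varphi(\mathbf{x})))$ for all $\mathbf{x}\in L_n([0,1])$.
   Context: $L_n([0,1])=\{(x_1,\ldots,x_n)\in[0,1]^n : x_1\leq\cdots\leq x_n\}$, with projections $\pi_i(x_1,\ldots,x_n)=x_i$ and the componentwise order. For $x\in[0,1]$, $/x/=(x,\ldots,x)$. An $n$-dimensional fuzzy negation is a function $\mathcal{N}:L_n([0,1])\to L_n([0,1])$ with $\mathcal{N}(/0/)=/1/$, $\mathcal{N}(/1/)=/0/$ and $\mathcal{N}(\mathbf{x})\geq\mathcal{N}(\mathbf{y})$ whenever $\mathbf{x}\leq\mathbf{y}$; it is strong if $\mathcal{N}(\mathcal{N}(\mathbf{x}))=\mathbf{x}$ for all $\mathbf{x}$. The standard one is $\mathcal{N}_S(\mathbf{x})=(1-\pi_n(\mathbf{x}),1-\pi_{n-1}(\mathbf{x}),\ldots,1-\pi_1(\mathbf{x}))$. An $n$-dimensional automorphism is a bijection $\varphi:L_n([0,1])\to L_n([0,1])$ such that $\mathbf{x}\leq\mathbf{y}$ iff $\varphi(\mathbf{x})\leq\varphi(\mathbf{y})$. -}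

module Defs where

open import Data.Empty using (⊥)
open import Data.Fin.Base using (Fin; opposite) renaming (_≤_ to _≤ꟳ_)
open import Data.Fin.Properties using (opposite-prop)
open import Data.Nat.Base using (ℕ; s≤s) renaming (_≤_ to _≤ℕ_)
import Data.Nat.Properties as ℕ
open import Data.Product.Base using (∃; _×_; _,_; proj₁; proj₂)
open import Data.Rational.Base using (ℚ; 0ℚ; 1ℚ; _+_; _-_; -_; _<_)
import Data.Rational.Properties as ℚ
open import Algebra.Properties.Group ℚ.+-0-group using (⁻¹-anti-homo-//)
open import Data.Sum.Base as Sum using (_⊎_; inj₁; inj₂)
open import Function.Base using (id)
open import Function.Bundles using (Func; Injection; Bijection; Inverse; _⇔_; _⟨$⟩_)
import Function.Construct.Composition as Composition
open import Function.Properties.Bijection using (Bijection⇒Inverse)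
open import Level using (0ℓ) renaming (suc to lsuc)
open import Relation.Binary.Bundles using (Poset; Setoid)
import Relation.Binary.Construct.On as On
open import Relation.Binary.Definitions using (tri<; tri≈; tri>)
open import Relation.Binary.PropositionalEquality
  using (_≡_; refl; sym; trans; cong; subst; subst₂)
open import Relation.Nullary.Negation using (contradiction)

-- Two-sided Dedekind cuts of ℚ.
record ℝ : Set₁ where
  field
    lower upper     : ℚ → Set
    lower-inhabited : ∃ lower
    upper-inhabited : ∃ upper
    lower-closed    : ∀ {p q} → p < q → lower q → lower p
    upper-closed    : ∀ {p q} → p < q → upper p → upper q
    lower-open      : ∀ {p} → lower p → ∃ λ q → p < q × lower q
    upper-open      : ∀ {q} → upper q → ∃ λ p → p < q × upper p
    disjoint        : ∀ {q} → lower q → upper q → ⊥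
    located         : ∀ {p q} → p < q → lower p ⊎ upper q

open ℝ

-- By locatedness, comparing lower cuts also compares upper cuts: see ≤ᵣ⇒upper.
infix 4 _≤ᵣ_ _≈ᵣ_

_≤ᵣ_ : ℝ → ℝ → Set
x ≤ᵣ y = ∀ q → lower x q → lower y q

_≈ᵣ_ : ℝ → ℝ → Set
x ≈ᵣ y = x ≤ᵣ y × y ≤ᵣ x

ℝ-poset : Poset (lsuc 0ℓ) 0ℓ 0ℓ
ℝ-poset = record
  { Carrier        = ℝ
  ; _≈_            = _≈ᵣ_
  ; _≤_            = _≤ᵣ_
  ; isPartialOrder = record
    { isPreorder = record
      { isEquivalence = record
        { refl  = (λ _ → id) , (λ _ → id)
        ; sym   = λ (p , q) → q , p
        ; trans = λ (p , q) (r , s) → (λ t l → r t (p t l)) , (λ t l → q t (s t l))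
        }
      ; reflexive = proj₁
      ; trans     = λ p q t l → q t (p t l)
      }
    ; antisym = _,_
    }
  }

≤ᵣ⇒upper : ∀ x y → x ≤ᵣ y → ∀ q → upper y q → upper x q
≤ᵣ⇒upper x y x≤y q u with upper-open y u
... | p , p<q , u′ with located x p<q
...   | inj₁ l = contradiction u′ (disjoint y (x≤y p l))
...   | inj₂ v = v

p-1<p : ∀ p → p - 1ℚ < p
p-1<p p = subst (p - 1ℚ <_) (ℚ.+-identityʳ p)
  (ℚ.+-monoʳ-< p (ℚ.negative⁻¹ (- 1ℚ)))

p<p+1 : ∀ p → p < p + 1ℚ
p<p+1 p = subst (_< p + 1ℚ) (ℚ.+-identityʳ p)
  (ℚ.+-monoʳ-< p (ℚ.positive⁻¹ 1ℚ))

reflect-< : ∀ c {p q} → p < q → c - q < c - p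
reflect-< c p<q = ℚ.+-monoʳ-< c (ℚ.neg-antimono-< p<q)

reflect-involutive : ∀ c p → c - (c - p) ≡ p
reflect-involutive c p = trans
  (cong (c +_) (⁻¹-anti-homo-// c p))
  (trans (ℚ.+-comm c (p - c))
  (trans (ℚ.+-assoc p (- c) c)
  (trans (cong (p +_) (ℚ.+-inverseˡ c)) (ℚ.+-identityʳ p))))

fromℚ : ℚ → ℝ
fromℚ c = record
  { lower           = _< c
  ; upper           = c <_
  ; lower-inhabited = c - 1ℚ , p-1<p c
  ; upper-inhabited = c + 1ℚ , p<p+1 c
  ; lower-closed    = ℚ.<-trans
  ; upper-closed    = λ p<q c<p → ℚ.<-trans c<p p<q
  ; lower-open      = ℚ.<-dense
  ; upper-open      = λ c<q → let p , c<p , p<q = ℚ.<-dense c<q in p , p<q , c<p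
  ; disjoint        = ℚ.<-asym
  ; located         = loc
  }
  where
  loc : ∀ {p q} → p < q → p < c ⊎ c < q
  loc {p} p<q with ℚ.<-cmp p c
  ... | tri< p<c _ _  = inj₁ p<c
  ... | tri≈ _ refl _ = inj₂ p<q
  ... | tri> _ _ c<p  = inj₂ (ℚ.<-trans c<p p<q)

0ᵣ 1ᵣ : ℝ
0ᵣ = fromℚ 0ℚ
1ᵣ = fromℚ 1ℚ

-- r < c - x iff x < c - r, and c - x < r iff c - r < x.
infixl 6 _-ᵣ_

_-ᵣ_ : ℚ → ℝ → ℝ
c -ᵣ x = record
  { lower           = λ r → upper x (c - r)
  ; upper           = λ r → lower x (c - r)
  ; lower-inhabited = let q , u = upper-inhabited x in c - q , back (upper x) u
  ; upper-inhabited = let q , l = lower-inhabited x in c - q , back (lower x) l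
  ; lower-closed    = λ p<q → upper-closed x (reflect-< c p<q)
  ; upper-closed    = λ p<q → lower-closed x (reflect-< c p<q)
  ; lower-open      = λ {r} u → let s , s<c-r , u′ = upper-open x u in
      c - s
    , subst (_< c - s) (reflect-involutive c r) (reflect-< c s<c-r)
    , back (upper x) u′
  ; upper-open      = λ {r} l → let s , c-r<s , l′ = lower-open x l in
      c - s
    , subst (c - s <_) (reflect-involutive c r) (reflect-< c c-r<s)
    , back (lower x) l′
  ; disjoint        = λ u l → disjoint x l u
  ; located         = λ p<q → Sum.swap (located x (reflect-< c p<q))
  }
  where
  back : (P : ℚ → Set) → ∀ {q} → P q → P (c - (c - q))
  back P {q} = subst P (sym (reflect-involutive c q))

record 𝕀 : Set₁ where
  field
    value : ℝ
    0≤    : 0ᵣ ≤ᵣ value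
    ≤1    : value ≤ᵣ 1ᵣ

open 𝕀

𝕀-poset : Poset (lsuc 0ℓ) 0ℓ 0ℓ
𝕀-poset = On.poset ℝ-poset value

module 𝕀ₚ = Poset 𝕀-poset

0𝕀 1𝕀 : 𝕀
0𝕀 = record { value = 0ᵣ ; 0≤ = λ _ → id ; ≤1 = λ _ q<0 → ℚ.<-trans q<0 (ℚ.positive⁻¹ 1ℚ) }
1𝕀 = record { value = 1ᵣ ; 0≤ = λ _ q<0 → ℚ.<-trans q<0 (ℚ.positive⁻¹ 1ℚ) ; ≤1 = λ _ → id }

infix 8 1-_

1-_ : 𝕀 → 𝕀
1- x = record
  { value = 1ℚ -ᵣ value x
  ; 0≤    = λ r r<0 → ≤ᵣ⇒upper (value x) 1ᵣ (≤1 x) (1ℚ - r) (reflect-< 1ℚ r<0)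
  ; ≤1    = λ r u → subst (_< 1ℚ) (reflect-involutive 1ℚ r)
              (reflect-< 1ℚ (≤ᵣ⇒upper 0ᵣ (value x) (0≤ x) (1ℚ - r) u))
  }

1-‿antitone : ∀ x y → x 𝕀ₚ.≤ y → 1- y 𝕀ₚ.≤ 1- x
1-‿antitone x y x≤y r = ≤ᵣ⇒upper (value x) (value y) x≤y (1ℚ - r)

-- Indices start at 0, so π x i is the coordinate x_{i+1}.
record L (n : ℕ) : Set₁ where
  field
    π          : Fin n → 𝕀
    increasing : ∀ {i j} → i ≤ꟳ j → π i 𝕀ₚ.≤ π j

open L public

L-poset : ℕ → Poset (lsuc 0ℓ) 0ℓ 0ℓ
L-poset n = record
  { Carrier        = L n
  ; _≈_            = λ x y → ∀ i → π x i 𝕀ₚ.≈ π y i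
  ; _≤_            = λ x y → ∀ i → π x i 𝕀ₚ.≤ π y i
  ; isPartialOrder = record
    { isPreorder = record
      { isEquivalence = record
        { refl  = λ {x} i → 𝕀ₚ.Eq.refl {π x i}
        ; sym   = λ {x y} p i → 𝕀ₚ.Eq.sym {π x i} {π y i} (p i)
        ; trans = λ {x y z} p q i →
                    𝕀ₚ.Eq.trans {π x i} {π y i} {π z i} (p i) (q i)
        }
      ; reflexive = λ {x y} p i → 𝕀ₚ.reflexive {π x i} {π y i} (p i)
      ; trans     = λ {x y z} p q i →
                      𝕀ₚ.trans {π x i} {π y i} {π z i} (p i) (q i)
      }
    ; antisym = λ {x y} p q i → 𝕀ₚ.antisym {π x i} {π y i} (p i) (q i)
    }
  }

L-setoid : ℕ → Setoid (lsuc 0ℓ) 0ℓ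
L-setoid n = Poset.Eq.setoid (L-poset n)

infix 4 _≤ᴸ_ _≈ᴸ_

_≤ᴸ_ : ∀ {n} → L n → L n → Set
_≤ᴸ_ {n} = Poset._≤_ (L-poset n)

_≈ᴸ_ : ∀ {n} → L n → L n → Set
_≈ᴸ_ {n} = Poset._≈_ (L-poset n)

/_/ : ∀ {n} → 𝕀 → L n
/ x / = record { π = λ _ → x ; increasing = λ _ → 𝕀ₚ.refl {x} }

-- Functions L_n → L_n must respect the equality of cuts.
Map : ℕ → Set₁
Map n = Func (L-setoid n) (L-setoid n)

record IsNegation {n} (N : Map n) : Set₁ where
  field
    N/0/     : N ⟨$⟩ / 0𝕀 / ≈ᴸ / 1𝕀 /
    N/1/     : N ⟨$⟩ / 1𝕀 / ≈ᴸ / 0𝕀 /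
    antitone : ∀ x y → x ≤ᴸ y → N ⟨$⟩ y ≤ᴸ N ⟨$⟩ x

record IsStrongNegation {n} (N : Map n) : Set₁ where
  field
    isNegation : IsNegation N
    involutive : ∀ x → N ⟨$⟩ (N ⟨$⟩ x) ≈ᴸ x

opposite-antitone : ∀ {n} {i j : Fin n} → i ≤ꟳ j → opposite j ≤ꟳ opposite i
opposite-antitone {n} {i} {j} i≤j =
  subst₂ _≤ℕ_ (sym (opposite-prop j)) (sym (opposite-prop i))
    (ℕ.∸-monoʳ-≤ n (s≤s i≤j))

N-S : ∀ {n} → Map n
N-S = record
  { to   = λ x → record
    { π          = λ i → 1- π x (opposite i)
    ; increasing = λ {i j} i≤j →
        1-‿antitone (π x (opposite j)) (π x (opposite i))
          (increasing x (opposite-antitone i≤j))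
    }
  ; cong = λ {x y} x≈y i →
      let a = π x (opposite i) ; b = π y (opposite i) ; p , q = x≈y (opposite i) in
      1-‿antitone b a q , 1-‿antitone a b p
  }

record Automorphism (n : ℕ) : Set₁ where
  field
    bijection : Bijection (L-setoid n) (L-setoid n)

  open Injection (Bijection.injection bijection) public using (function)

  field
    order : ∀ x y → x ≤ᴸ y ⇔ function ⟨$⟩ x ≤ᴸ function ⟨$⟩ y

  inverse : Map n
  inverse = record { to = from ; cong = from-cong }
    where open Inverse (Bijection⇒Inverse bijection)

-- N ^ φ is φ⁻¹ ∘ N ∘ φ: Composition.function composes left to right.
infixl 10 _^_

_^_ : ∀ {n} → Map n → Automorphism n → Map n
N ^ φ = Composition.function (Composition.function φ.function N) φ.inverse
  where module φ = Automorphism φ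

{-# OPTIONS --safe #-}
module Submission where

open import Defs
open import Data.Empty using (⊥; ⊥-elim)
open import Data.Fin.Base as Fin using (Fin; toℕ; fromℕ<; opposite)
open import Data.Fin.Properties using (toℕ<n; toℕ-injective; toℕ-fromℕ<; opposite-involutive)
open import Data.Integer.Base as ℤ using (+_; -[1+_])
import Data.Integer.Properties as ℤ
open import Data.Nat.Base as ℕ using (ℕ; zero; suc; _≥_; z≤n; s≤s)
open import Data.Nat.Coprimality as Coprimality using (1-coprimeTo)
import Data.Nat.Properties as ℕ
open import Data.Product.Base using (∃; ∃₂; Σ; _×_; _,_; proj₁; proj₂)
open import Data.Rational.Base as ℚ hiding (_≥_; _/_)
open import Data.Rational.Properties
open import Data.Rational.Solver using (module +-*-Solver)
import Data.Rational.Unnormalised.Base as ℚᵘ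
import Data.Rational.Unnormalised.Properties as ℚᵘ
open import Data.Sum.Base as Sum using (_⊎_; inj₁; inj₂; [_,_]′)
open import Function.Base using (id; _∘_)
open import Function.Bundles using (_⇔_; _⟨$⟩_; Func; mk⇔; Equivalence; Bijection)
import Level
open import Relation.Binary.Bundles using (Poset)
open import Relation.Binary.Definitions using (tri<; tri≈; tri>)
open import Relation.Binary.PropositionalEquality
  using (_≡_; refl; sym; trans; cong; subst; subst₂)
open import Relation.Nullary.Decidable using (yes; no)
open import Relation.Nullary.Negation using (¬_; contradiction)
open +-*-Solver using (solve; con; _:+_; _:*_; _:-_; :-_; _:=_)

open ℝ
open 𝕀

-- If N is strong, A = N_S ∘ N is an order automorphism of L_n and φ x = (x + A x) / 2
-- satisfies φ ∘ N = N_S ∘ φ, so the point is that φ is an automorphism. A fixes every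
-- (0,…,0,1,…,1), hence acts on each coordinate separately, (A x)_i = α (x_i) with α an order
-- automorphism of [0,1], and φ acts by t ↦ (t + α t) / 2. The latter grows at rate at least 1/2,
-- which makes it reflect the order and lets the solution of (t + α t) / 2 = c be defined as a
-- located cut without knowing that α is continuous; that it is a solution is a negative
-- statement, and may be proved by contradiction.

private variable n : ℕ

-- Midpoints of rationals.

abstract
  between : ∀ {p q} → p < q → ∃ λ r → p < r × r < q
  between = <-dense

  mid : ℚ → ℚ → ℚ
  mid p r = ½ * (p + r)

  mid-idem : ∀ p → mid p p ≡ p
  mid-idem = solve 1 (λ p → con ½ :* (p :+ p) := p) refl

  mid-comm : ∀ p r → mid p r ≡ mid r p
  mid-comm p r = cong (½ *_) (+-comm p r)

  mid-complement : ∀ k p → mid p (k + k - p) ≡ k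
  mid-complement = solve 2 (λ k p → con ½ :* (p :+ (k :+ k :- p)) := k) refl

  reflect-mid : ∀ c p r → c - mid p r ≡ mid (c - p) (c - r)
  reflect-mid = solve 3
    (λ c p r → c :- con ½ :* (p :+ r) := con ½ :* ((c :- p) :+ (c :- r))) refl

  +-<⇒mid-< : ∀ {p q r s} → p + r < q + s → mid p r < mid q s
  +-<⇒mid-< = *-monoʳ-<-pos ½

  mid-<⇒+-< : ∀ {p q r s} → mid p r < mid q s → p + r < q + s
  mid-<⇒+-< = *-cancelˡ-<-nonNeg ½

mid-mono-< : ∀ {p q r s} → p < q → r < s → mid p r < mid q s
mid-mono-< p<q r<s = +-<⇒mid-< (+-mono-< p<q r<s)

mid-mono-<-≤ : ∀ {p q r s} → p < q → r ≤ s → mid p r < mid q s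
mid-mono-<-≤ p<q r≤s = +-<⇒mid-< (+-mono-<-≤ p<q r≤s)

mid-<⇒--< : ∀ s s′ p p′ → mid s p′ < mid s′ p → s - p < s′ - p′
mid-<⇒--< s s′ p p′ lt =
  subst₂ _<_ (e s p p′) (e′ s′ p p′) (+-monoˡ-< (- (p + p′)) (mid-<⇒+-< lt))
  where
  e : ∀ s p p′ → s + p′ - (p + p′) ≡ s - p
  e = solve 3 (λ s p p′ → s :+ p′ :- (p :+ p′) := s :- p) refl
  e′ : ∀ s p p′ → s + p - (p + p′) ≡ s - p′
  e′ = solve 3 (λ s p p′ → s :+ p :- (p :+ p′) := s :- p′) refl

-- Rational brackets of a real, as narrow as desired.

lower<upper : ∀ x {p q} → lower x p → upper x q → p < q
lower<upper x {p} {q} l u with <-cmp p q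
... | tri< p<q _ _  = p<q
... | tri≈ _ refl _ = contradiction u (disjoint x l)
... | tri> _ _ q<p  = contradiction u (disjoint x (lower-closed x q<p l))

fromℕ : ℕ → ℚ
fromℕ k = mkℚ (+ k) 0 (Coprimality.sym (1-coprimeTo k))

fromℕ-suc : ∀ k → fromℕ (suc k) ≡ 1ℚ + fromℕ k
fromℕ-suc k = toℚᵘ-injective (ℚᵘ.≃-sym (ℚᵘ.≃-trans (toℚᵘ-homo-+ 1ℚ (fromℕ k))
  (ℚᵘ.*≡* (cong (ℤ._* + 1) (cong (ℤ._+_ (+ 1)) (ℤ.*-identityʳ (+ k)))))))

archimedean : ∀ p → ∃ λ k → p < fromℕ k
archimedean (mkℚ (+ n) d _) = suc n , *<* (begin-strict
  + n ℤ.* + 1          ≡⟨ ℤ.*-identityʳ (+ n) ⟩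
  + n                  <⟨ ℤ.+<+ (ℕ.n<1+n n) ⟩
  + suc n              ≤⟨ ℤ.+≤+ (ℕ.m≤m*n (suc n) (suc d)) ⟩
  + (suc n ℕ.* suc d)  ≡⟨ ℤ.pos-* (suc n) (suc d) ⟩
  + suc n ℤ.* + suc d  ∎)
  where open ℤ.≤-Reasoning
archimedean p@(mkℚ -[1+ n ] d _) = 0 , negative⁻¹ p

-- Walks up from a lower bound in steps of δ.
approximate : ∀ x {δ} → 0ℚ < δ → ∃ λ r → lower x r × upper x (r + (δ + δ))
approximate x {δ} 0<δ = search k a la (upper-closed x b<a+kδ ub)
  where
  instance
    δ-positive : Positive δ
    δ-positive = positive 0<δ

    δ-nonZero : NonZero δ
    δ-nonZero = pos⇒nonZero δ

  a b : ℚ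
  a = proj₁ (lower-inhabited x)
  b = proj₁ (upper-inhabited x)

  la : lower x a
  la = proj₂ (lower-inhabited x)

  ub : upper x b
  ub = proj₂ (upper-inhabited x)

  k : ℕ
  k = proj₁ (archimedean ((b - a) * 1/ δ))

  b<a+kδ : b < a + fromℕ k * δ
  b<a+kδ = subst (_< a + fromℕ k * δ) e
    (+-monoʳ-< a (*-monoˡ-<-pos δ (proj₂ (archimedean ((b - a) * 1/ δ)))))
    where
    e : a + (b - a) * 1/ δ * δ ≡ b
    e = trans (cong (_+_ a) (trans (*-assoc (b - a) (1/ δ) δ)
          (trans (cong ((b - a) *_) (*-inverseˡ δ)) (*-identityʳ (b - a)))))
        (solve 2 (λ a b → a :+ (b :- a) := b) refl a b)

  search : ∀ k a → lower x a → upper x (a + fromℕ k * δ) →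
           ∃ λ r → lower x r × upper x (r + (δ + δ))
  search zero a l u = contradiction
    (subst (upper x) (trans (cong (_+_ a) (*-zeroˡ δ)) (+-identityʳ a)) u) (disjoint x l)
  -- Testing `a + δ` against `a + 2δ` either stops with a bracket of width `2δ` or moves `a` up by
  -- `δ`; the counter bounds the moves.
  search (suc k) a l u with located x (+-monoʳ-< a δ<2δ)
    where
    δ<2δ : δ < δ + δ
    δ<2δ = subst (_< δ + δ) (+-identityʳ δ) (+-monoʳ-< δ 0<δ)
  ... | inj₂ u′ = a , l , u′
  ... | inj₁ l′ = search k (a + δ) l′ (subst (upper x) e u)
    where
    e : a + fromℕ (suc k) * δ ≡ a + δ + fromℕ k * δ
    e = trans (cong (λ m → a + m * δ) (fromℕ-suc k))
      (solve 3 (λ a d m → a :+ (con 1ℚ :+ m) :* d := a :+ d :+ m :* d) refl a δ (fromℕ k))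

⅓ : ℚ
⅓ = + 1 ℚ./ 3

-- The last inequality says `r′ - r < s′ - s`: the bracket is narrower than the given gap. In terms
-- of midpoints, `located` applies to it directly.
narrow : ∀ x {s s′} → s < s′ →
         ∃₂ λ r r′ → lower x r × upper x r′ × mid s r′ < mid s′ r
narrow x {s} {s′} s<s′ = r , r + (δ + δ) , l , u , +-<⇒mid-< shifted
  where
  -- A third of the gap: the bracket uses up `2δ`, and the remaining `δ` makes the inequality
  -- strict.
  δ : ℚ
  δ = ⅓ * (s′ - s)

  0<δ : 0ℚ < δ
  0<δ = subst (_< δ) (solve 1 (λ s → con ⅓ :* (s :- s) := con 0ℚ) refl s)
    (*-monoʳ-<-pos ⅓ (+-monoˡ-< (- s) s<s′))

  open Σ (approximate x 0<δ) renaming (proj₁ to r; proj₂ to bounds)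
  l = proj₁ bounds
  u = proj₂ bounds

  shifted : s + (r + (δ + δ)) < s′ + r
  shifted = subst₂ _<_ (+-identityʳ _)
    (solve 3 (λ s s′ r → let d = con ⅓ :* (s′ :- s) in
       s :+ (r :+ (d :+ d)) :+ d := s′ :+ r) refl s s′ r)
    (+-monoʳ-< (s + (r + (δ + δ))) 0<δ)

-- Averages of reals.

avgᵣ : ℝ → ℝ → ℝ
avgᵣ x y = record
  { lower           = λ m → ∃₂ λ p r → lower x p × lower y r × m < mid p r
  ; upper           = λ m → ∃₂ λ p r → upper x p × upper y r × mid p r < m
  ; lower-inhabited = let p , l = lower-inhabited x ; r , l′ = lower-inhabited y in
      mid p r - 1ℚ , p , r , l , l′ , p-1<p (mid p r)
  ; upper-inhabited = let p , u = upper-inhabited x ; r , u′ = upper-inhabited y in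
      mid p r + 1ℚ , p , r , u , u′ , p<p+1 (mid p r)
  ; lower-closed    = λ m<m′ (p , r , l , l′ , lt) → p , r , l , l′ , <-trans m<m′ lt
  ; upper-closed    = λ m<m′ (p , r , u , u′ , lt) → p , r , u , u′ , <-trans lt m<m′
  ; lower-open      = λ (p , r , l , l′ , lt) → let m , m₁ , m₂ = between lt in
      m , m₁ , p , r , l , l′ , m₂
  ; upper-open      = λ (p , r , u , u′ , lt) → let m , m₁ , m₂ = between lt in
      m , m₂ , p , r , u , u′ , m₁
  ; disjoint        = λ (p , r , l , l′ , lt) (q , s , u , u′ , lt′) →
      <-asym (<-trans lt (mid-mono-< (lower<upper x l u) (lower<upper y l′ u′))) lt′
  ; located         = loc
  }
  where
  loc : ∀ {m m′} → m < m′ →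
        (∃₂ λ p r → lower x p × lower y r × m < mid p r) ⊎
        (∃₂ λ p r → upper x p × upper y r × mid p r < m′)
  loc {m} {m′} m<m′ =
    -- The bracket of `x` is narrower than `2 (k′ - k)`, so `2k - p < 2k′ - p′` and `y` can be
    -- located between them. Their midpoints with `p` and `p′` respectively are `k` and `k′`.
    let k , m<k , k<m′ = between m<m′ ; k′ , k<k′ , k′<m′ = between k<m′ in
    split m<k k′<m′ (narrow x (+-mono-< k<k′ k<k′))
    where
    split : ∀ {k k′} → m < k → k′ < m′ →
            (∃₂ λ p p′ → lower x p × upper x p′ × mid (k + k) p′ < mid (k′ + k′) p) →
            (∃₂ λ p r → lower x p × lower y r × m < mid p r) ⊎
            (∃₂ λ p r → upper x p × upper y r × mid p r < m′)
    split {k} {k′} m<k k′<m′ (p , p′ , l , u , lt) = Sum.map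
      (λ l′ → p , k + k - p , l , l′ , subst (m <_) (sym (mid-complement k p)) m<k)
      (λ u′ → p′ , k′ + k′ - p′ , u , u′ , subst (_< m′) (sym (mid-complement k′ p′)) k′<m′)
      (located y (mid-<⇒--< (k + k) (k′ + k′) p p′ lt))

-- The order of cuts and arguments by contradiction.

infixr 9 _⨾_

-- Transitivity of `≤ᵣ` on the unfolded inclusions of lower cuts: the predicates can be inferred
-- from these, the reals cannot.
_⨾_ : {P Q R : ℚ → Set} → (∀ q → P q → Q q) → (∀ q → Q q → R q) → ∀ q → P q → R q
(f ⨾ g) q = g q ∘ f q

-- A lower bound `q` of `y` can be raised to some `p`, and locating `x` between `q` and `p` leaves
-- only `q` below `x`. Hence any `≤ᵣ` may be proved by refuting a strict inequality.
≮⇒≥ᵣ : ∀ x y → (∀ q → upper x q → ¬ lower y q) → y ≤ᵣ x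
≮⇒≥ᵣ x y x≮y q l =
  let p , q<p , l′ = lower-open y l in
  [ id , (λ u → contradiction l′ (x≮y p u)) ]′ (located x q<p)

<⇒≱ᵣ : ∀ x y {q} → upper x q → lower y q → ¬ (y ≤ᵣ x)
<⇒≱ᵣ x y u l y≤x = disjoint x (y≤x _ l) u

<⇒≤ᵣ : ∀ x y {q} → upper x q → lower y q → x ≤ᵣ y
<⇒≤ᵣ x y u l p l′ = lower-closed y (lower<upper x l′ u) l

≰⇒≥ᵣ : ∀ x y → ¬ (x ≤ᵣ y) → y ≤ᵣ x
≰⇒≥ᵣ x y x≰y = ≮⇒≥ᵣ x y λ q u l → x≰y (<⇒≤ᵣ x y u l)

≤ᵣ-stable : ∀ x y → ¬ ¬ (x ≤ᵣ y) → x ≤ᵣ y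
≤ᵣ-stable x y ¬¬x≤y = ≮⇒≥ᵣ y x λ q u l → ¬¬x≤y (<⇒≱ᵣ y x u l)

avgᵣ-mono : ∀ x x′ y y′ → x ≤ᵣ x′ → y ≤ᵣ y′ → avgᵣ x y ≤ᵣ avgᵣ x′ y′
avgᵣ-mono x x′ y y′ x≤x′ y≤y′ m (p , r , l , l′ , lt) = p , r , x≤x′ p l , y≤y′ r l′ , lt

-- If `y < x`, a gap from `p` to `q` separates them. With a bracket of `a` narrower than this gap,
-- `b ≤ᵣ a` makes the averages differ strictly in the same direction.
avgᵣ-cancel : ∀ x y a b → b ≤ᵣ a → avgᵣ x a ≤ᵣ avgᵣ y b → x ≤ᵣ y
avgᵣ-cancel x y a b b≤a avg≤ = ≮⇒≥ᵣ y x λ q u l →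
  let p , p<q , u′        = upper-open y u
      r , r′ , l″ , u″ , lt = narrow a p<q
      m , lt₁ , lt₂        = between lt
  in disjoint (avgᵣ y b) (avg≤ m (q , r , l , l″ , lt₂))
       (p , r′ , u′ , ≤ᵣ⇒upper b a b≤a r′ u″ , lt₁)

avg : 𝕀 → 𝕀 → 𝕀
avg x y = record
  { value = avgᵣ (value x) (value y)
  ; 0≤ = λ m m<0 → let p , m<p , p<0 = between m<0 in
      p , p , 0≤ x p p<0 , 0≤ y p p<0 , subst (m <_) (sym (mid-idem p)) m<p
  ; ≤1 = λ m (p , r , l , l′ , lt) → <-trans lt
      (subst (mid p r <_) (mid-idem 1ℚ) (mid-mono-< (≤1 x p l) (≤1 y r l′)))
  }

1-‿involutive : ∀ x → 1- 1- x 𝕀ₚ.≈ x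
1-‿involutive x =
    (λ q → subst (lower (value x)) (reflect-involutive 1ℚ q))
  , (λ q → subst (lower (value x)) (sym (reflect-involutive 1ℚ q)))

avgᵣ-comm-≤ : ∀ x y → avgᵣ x y ≤ᵣ avgᵣ y x
avgᵣ-comm-≤ x y m (p , r , l , l′ , lt) = r , p , l′ , l , subst (m <_) (mid-comm p r) lt

1-avg : ∀ x y → 1- avg x y 𝕀ₚ.≈ avg (1- x) (1- y)
1-avg x y = to , from
  where
  back : ∀ z {p} → upper (value z) p → upper (value z) (1ℚ - (1ℚ - p))
  back z = subst (upper (value z)) (sym (reflect-involutive 1ℚ _))

  to : 1- avg x y 𝕀ₚ.≤ avg (1- x) (1- y)
  to m (p , r , u , u′ , lt) = 1ℚ - p , 1ℚ - r , back x u , back y u′ ,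
    subst₂ _<_ (reflect-involutive 1ℚ m) (reflect-mid 1ℚ p r) (reflect-< 1ℚ lt)

  from : avg (1- x) (1- y) 𝕀ₚ.≤ 1- avg x y
  from m (p , r , u , u′ , lt) = 1ℚ - p , 1ℚ - r , u , u′ ,
    subst (_< 1ℚ - m) (reflect-mid 1ℚ p r) (reflect-< 1ℚ lt)

-- Rational points of the unit interval.

rational : ∀ q → 0ℚ ≤ q → q ≤ 1ℚ → 𝕀
rational q 0≤q q≤1 = record
  { value = fromℚ q
  ; 0≤ = λ p p<0 → <-≤-trans p<0 0≤q
  ; ≤1 = λ p p<q → <-≤-trans p<q q≤1
  }

-- Total on `ℚ`, so that a map on `𝕀` can be tested at every rational while a cut is being defined.
clamp : ℚ → 𝕀
clamp q = rational (0ℚ ⊔ (q ⊓ 1ℚ)) (p≤p⊔q 0ℚ (q ⊓ 1ℚ))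
  (⊔-lub (<⇒≤ (positive⁻¹ 1ℚ)) (p⊓q≤q q 1ℚ))

clamp-mono : ∀ {p q} → p ≤ q → clamp p 𝕀ₚ.≤ clamp q
clamp-mono p≤q s s<p = <-≤-trans s<p (⊔-mono-≤ (≤-refl {0ℚ}) (⊓-mono-≤ p≤q (≤-refl {1ℚ})))

⊓-glb-< : ∀ {p q r} → r < p → r < q → r < p ⊓ q
⊓-glb-< {p} {q} {r} r<p r<q =
  [ (λ e → subst (r <_) (sym e) r<p) , (λ e → subst (r <_) (sym e) r<q) ]′ (⊓-sel p q)

⊔-lub-< : ∀ {p q r} → p < r → q < r → p ⊔ q < r
⊔-lub-< {p} {q} {r} p<r q<r =
  [ (λ e → subst (_< r) (sym e) p<r) , (λ e → subst (_< r) (sym e) q<r) ]′ (⊔-sel p q)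

upper⇒≤-clamp : ∀ z {q} → upper (value z) q → z 𝕀ₚ.≤ clamp q
upper⇒≤-clamp z {q} u p l = <-≤-trans
  (⊓-glb-< (lower<upper (value z) l u) (≤1 z p l)) (p≤q⊔p 0ℚ (q ⊓ 1ℚ))

lower⇒clamp-≤ : ∀ z {q} → lower (value z) q → clamp q 𝕀ₚ.≤ z
lower⇒clamp-≤ z {q} l p p<q =
  [ (λ e → 0≤ z p (subst (p <_) e p<q))
  , (λ e → lower-closed (value z) (<-≤-trans (subst (p <_) e p<q) (p⊓q≤p q 1ℚ)) l)
  ]′ (⊔-sel 0ℚ (q ⊓ 1ℚ))

upper⇒clamp-< : ∀ z {q p} → upper (value z) q → q < p → upper (value (clamp q)) p
upper⇒clamp-< z {q} u q<p = ⊔-lub-<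
  (<-trans (≤ᵣ⇒upper 0ᵣ (value z) (0≤ z) q u) q<p) (≤-<-trans (p⊓q≤p q 1ℚ) q<p)

lower⇒<-clamp : ∀ z {q p} → lower (value z) q → p < q → lower (value (clamp q)) p
lower⇒<-clamp z {q} l p<q = <-≤-trans
  (⊓-glb-< p<q (<-trans p<q (≤1 z q l))) (p≤q⊔p 0ℚ (q ⊓ 1ℚ))

-- Order isomorphisms and the equation `avg x (α x) = c`.

record OrderIso {c ℓ₁ ℓ₂} (P : Poset c ℓ₁ ℓ₂) : Set (c Level.⊔ ℓ₁ Level.⊔ ℓ₂) where
  open Poset P using (Carrier; _≈_) renaming (_≤_ to _≤ₚ_)
  field
    to from   : Carrier → Carrier
    to-mono   : ∀ x y → x ≤ₚ y → to x ≤ₚ to y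
    from-mono : ∀ x y → x ≤ₚ y → from x ≤ₚ from y
    to-from   : ∀ x → to (from x) ≈ x
    from-to   : ∀ x → from (to x) ≈ x

flip : ∀ {c ℓ₁ ℓ₂} {P : Poset c ℓ₁ ℓ₂} → OrderIso P → OrderIso P
flip I = record
  { to = from ; from = to ; to-mono = from-mono ; from-mono = to-mono
  ; to-from = from-to ; from-to = to-from }
  where open OrderIso I

avgWith : (𝕀 → 𝕀) → 𝕀 → 𝕀
avgWith α x = avg x (α x)

-- x + α x grows at least as fast as x, so comparing it with c at rational points locates the
-- solution of avg x (α x) = c. Continuity of α enters only negatively, through surjectivity.
module Solve (I : OrderIso 𝕀-poset) (c : 𝕀) where
  open OrderIso I renaming (to to α; from to β; to-mono to α-mono; from-mono to β-mono)

  α≤0 : ∀ {s} → s < 0ℚ → α (clamp s) 𝕀ₚ.≤ 0𝕀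
  α≤0 {s} s<0 =
    α-mono (clamp s) (β 0𝕀) (lower⇒clamp-≤ 0𝕀 s<0 ⨾ 0≤ (β 0𝕀)) ⨾ proj₁ (to-from 0𝕀)

  1≤α : ∀ {s} → 1ℚ < s → 1𝕀 𝕀ₚ.≤ α (clamp s)
  1≤α {s} 1<s =
    proj₂ (to-from 1𝕀) ⨾ α-mono (β 1𝕀) (clamp s) (≤1 (β 1𝕀) ⨾ upper⇒≤-clamp 1𝕀 1<s)

  -- Witnessed forms of `(s + α s) / 2 < c` and `c < (s + α s) / 2`. The summand `s` is not clamped,
  -- so that the sum increases strictly on all of `ℚ`, as `Below⊎Above` requires.
  Below Above : ℚ → Set
  Below s = ∃ λ r → upper (value (α (clamp s))) r × lower (value c) (mid s r)
  Above s = ∃ λ r → lower (value (α (clamp s))) r × upper (value c) (mid s r)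

  Below<Above : ∀ {s t} → Below s → Above t → s < t
  Below<Above {s} {t} (r , u , l) (q , l′ , u′) = ≰⇒> λ t≤s →
    let q<r = lower<upper (value (α (clamp s)))
                (α-mono (clamp t) (clamp s) (clamp-mono t≤s) q l′) u
    in <-asym (lower<upper (value c) l u′)
         (subst₂ _<_ (mid-comm q t) (mid-comm r s) (mid-mono-<-≤ q<r t≤s))

  -- From `s` to `t` the sum grows by at least `t - s`. A bracket of `α (clamp s)` narrower than
  -- that yields two rationals between which `c` is located, whether or not `α` jumps.
  Below⊎Above : ∀ {s t} → s < t → Below s ⊎ Above t
  Below⊎Above {s} {t} s<t =
    let r , r′ , l , u , lt = narrow (value (α (clamp s))) s<t in
    Sum.map (λ l′ → r′ , u , l′)
            (λ u′ → r , α-mono (clamp s) (clamp t) (clamp-mono (<⇒≤ s<t)) r l , u′)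
            (located (value c) lt)

  <0⇒¬Above : ∀ {s} → s < 0ℚ → ¬ Above s
  <0⇒¬Above {s} s<0 (r , l , u) = <-asym
    (≤ᵣ⇒upper 0ᵣ (value c) (0≤ c) _ u)
    (subst (mid s r <_) (mid-idem 0ℚ) (mid-mono-< s<0 (α≤0 s<0 r l)))

  1<⇒¬Below : ∀ {s} → 1ℚ < s → ¬ Below s
  1<⇒¬Below {s} 1<s (r , u , l) = <-asym
    (≤1 c _ l)
    (subst (_< mid s r) (mid-idem 1ℚ)
      (mid-mono-< 1<s (≤ᵣ⇒upper 1ᵣ (value (α (clamp s))) (1≤α 1<s) r u)))

  -- The strict inequality makes both cuts open, whether or not `α` is continuous.
  Lower Upper : ℚ → Set
  Lower q = ∃ λ s → q < s × Below s
  Upper q = ∃ λ s → s < q × Above s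

  <0⇒Lower : ∀ {q} → q < 0ℚ → Lower q
  <0⇒Lower q<0 =
    let s , q<s , s<0 = between q<0 ; t , s<t , t<0 = between s<0 in
    s , q<s , [ id , (λ a → contradiction a (<0⇒¬Above t<0)) ]′ (Below⊎Above s<t)

  1<⇒Upper : ∀ {q} → 1ℚ < q → Upper q
  1<⇒Upper 1<q =
    let t , 1<t , t<q = between 1<q ; s , 1<s , s<t = between 1<t in
    t , t<q , [ (λ b → contradiction b (1<⇒¬Below 1<s)) , id ]′ (Below⊎Above s<t)

  root : 𝕀
  root = record
    { value = record
      { lower = Lower
      ; upper = Upper
      ; lower-inhabited = - 1ℚ , <0⇒Lower (negative⁻¹ (- 1ℚ))
      ; upper-inhabited = 1ℚ + 1ℚ , 1<⇒Upper (p<p+1 1ℚ)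
      ; lower-closed = λ p<q (s , q<s , b) → s , <-trans p<q q<s , b
      ; upper-closed = λ p<q (s , s<p , a) → s , <-trans s<p p<q , a
      ; lower-open = λ (s , q<s , b) → let p , q<p , p<s = between q<s in p , q<p , s , p<s , b
      ; upper-open = λ (s , s<q , a) → let p , s<p , p<q = between s<q in p , p<q , s , s<p , a
      ; disjoint = λ (s , q<s , b) (t , t<q , a) → <-asym (Below<Above b a) (<-trans t<q q<s)
      ; located = λ p<q →
          let s , p<s , s<q = between p<q ; t , s<t , t<q = between s<q in
          Sum.map (λ b → s , p<s , b) (λ a → t , t<q , a) (Below⊎Above s<t)
      }
    ; 0≤ = λ q q<0 → <0⇒Lower q<0
    ; ≤1 = λ q (s , q<s , b) → <-≤-trans q<s (≮⇒≥ λ 1<s → 1<⇒¬Below 1<s b)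
    }

  -- Suppose `root < p`, `α root < r` and `(p + r) / 2 < c`. Any `s` with `root < s < p` and
  -- `α s < r` would be `Below`, so `α` jumps to at least `r` right after the root. But then `β r`
  -- lies below every such `s`, hence below the root, and `r ≤ α root`.
  c≤avg : c 𝕀ₚ.≤ avgWith α root
  c≤avg = ≮⇒≥ᵣ (value (avgWith α root)) (value c) absurd
    where
    absurd : ∀ m → upper (value (avgWith α root)) m → ¬ lower (value c) m
    absurd m (p , r , uₚ , uᵣ , lt) lₘ =
      let r′ , r′<r , u′ = upper-open (value (α root)) uᵣ in
      disjoint (value (α root)) (ρ≤αroot r′ r′<r) u′
      where
      α≮r : ∀ {s} → s < p → Upper s → ¬ upper (value (α (clamp s))) r
      α≮r {s} s<p uₛ u =
        let s′ , s′<s , uₛ′ = upper-open (value root) uₛ in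
        disjoint (value root)
          (s , s′<s , r , u ,
            lower-closed (value c) (<-trans (mid-mono-<-≤ s<p (≤-refl {r})) lt) lₘ)
          uₛ′

      0≤r : 0ℚ ≤ r
      0≤r = <⇒≤ (≤ᵣ⇒upper 0ᵣ (value (α root)) (0≤ (α root)) r uᵣ)

      r≤1 : r ≤ 1ℚ
      r≤1 = ≮⇒≥ λ 1<r →
        let s , s<p , uₛ = upper-open (value root) uₚ in
        α≮r s<p uₛ (≤ᵣ⇒upper (value (α (clamp s))) 1ᵣ (≤1 (α (clamp s))) r 1<r)

      ρ : 𝕀
      ρ = rational r 0≤r r≤1

      ρ≤α : ∀ {s} → s < p → Upper s → ρ 𝕀ₚ.≤ α (clamp s)
      ρ≤α {s} s<p uₛ = ≮⇒≥ᵣ (value (α (clamp s))) (value ρ) λ q u q<r →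
        α≮r s<p uₛ (upper-closed (value (α (clamp s))) q<r u)

      βρ≤root : β ρ 𝕀ₚ.≤ root
      βρ≤root = ≮⇒≥ᵣ (value root) (value (β ρ)) λ q u l →
        let t , t<q , uₜ = upper-open (value root) u
            -- `s` must be below `p` for `ρ ≤ α s` and below `q` for the contradiction; `t ⊓ p`
            -- still lies above the root.
            s , s<t⊓p , u⊓ = upper-open (value root)
              ([ (λ e → subst Upper (sym e) uₜ) , (λ e → subst Upper (sym e) uₚ) ]′ (⊓-sel t p))
            s<p = <-≤-trans s<t⊓p (p⊓q≤q t p)
            s<q = <-trans (<-≤-trans s<t⊓p (p⊓q≤p t p)) t<q
            βρ≤s = β-mono ρ (α (clamp s)) (ρ≤α s<p u⊓) ⨾ proj₁ (from-to (clamp s))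
        in disjoint (value (clamp s)) (βρ≤s q l) (upper⇒clamp-< root u⊓ s<q)

      ρ≤αroot : ρ 𝕀ₚ.≤ α root
      ρ≤αroot = proj₂ (to-from ρ) ⨾ α-mono (β ρ) root βρ≤root

  -- The mirror image: `α` stays below `r` just left of the root, so `root ≤ β r`, contradicting
  -- `r < α root`.
  avg≤c : avgWith α root 𝕀ₚ.≤ c
  avg≤c = ≮⇒≥ᵣ (value c) (value (avgWith α root)) λ m u l → absurd m l u
    where
    absurd : ∀ m → lower (value (avgWith α root)) m → ¬ upper (value c) m
    absurd m (p , r , lₚ , lᵣ , lt) uₘ = <-irrefl refl (αroot≤ρ r lᵣ)
      where
      α≯r : ∀ {s} → p < s → Lower s → ¬ lower (value (α (clamp s))) r
      α≯r {s} p<s lₛ l =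
        let s′ , s<s′ , lₛ′ = lower-open (value root) lₛ in
        disjoint (value root) lₛ′
          (s , s<s′ , r , l ,
            upper-closed (value c) (<-trans lt (mid-mono-<-≤ p<s (≤-refl {r}))) uₘ)

      0≤r : 0ℚ ≤ r
      0≤r = ≮⇒≥ λ r<0 →
        let s , p<s , lₛ = lower-open (value root) lₚ in
        α≯r p<s lₛ (0≤ (α (clamp s)) r r<0)

      r≤1 : r ≤ 1ℚ
      r≤1 = <⇒≤ (≤1 (α root) r lᵣ)

      ρ : 𝕀
      ρ = rational r 0≤r r≤1

      α≤ρ : ∀ {s} → p < s → Lower s → α (clamp s) 𝕀ₚ.≤ ρ
      α≤ρ {s} p<s lₛ = ≮⇒≥ᵣ (value ρ) (value (α (clamp s))) λ q r<q l →
        α≯r p<s lₛ (lower-closed (value (α (clamp s))) r<q l)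

      root≤βρ : root 𝕀ₚ.≤ β ρ
      root≤βρ q l =
        let t , q<t , lₜ = lower-open (value root) l
            s , <s , lₛ = lower-open (value root)
              ([ (λ e → subst Lower (sym e) lₜ) , (λ e → subst Lower (sym e) lₚ) ]′ (⊔-sel t p))
            p<s = ≤-<-trans (p≤q⊔p t p) <s
            q<s = <-trans q<t (≤-<-trans (p≤p⊔q t p) <s)
        in (proj₂ (from-to (clamp s)) ⨾ β-mono (α (clamp s)) ρ (α≤ρ p<s lₛ))
             q (lower⇒<-clamp root lₛ q<s)

      αroot≤ρ : α root 𝕀ₚ.≤ ρ
      αroot≤ρ = α-mono root (β ρ) root≤βρ ⨾ proj₁ (to-from ρ)

-- If `x ≤ y` failed, then `y ≤ x` and so `α y ≤ α x`, as `avgᵣ-cancel` needs; stability of `≤ᵣ`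
-- permits this assumption.
avgWith-reflects-≤ : ∀ (α : 𝕀 → 𝕀) → (∀ x y → x 𝕀ₚ.≤ y → α x 𝕀ₚ.≤ α y) →
                     ∀ x y → avgWith α x 𝕀ₚ.≤ avgWith α y → x 𝕀ₚ.≤ y
avgWith-reflects-≤ α α-mono x y avg≤ = ≤ᵣ-stable (value x) (value y) λ x≰y → x≰y
  (avgᵣ-cancel (value x) (value y) (value (α x)) (value (α y))
    (α-mono y x (≰⇒≥ᵣ (value x) (value y) x≰y)) avg≤)

-- Step vectors and corners.

level : ℕ → ℕ → 𝕀 → ℕ → 𝕀
level a b s j with j ℕ.<? a | j ℕ.<? b
... | yes _ | _     = 0𝕀
... | no _  | yes _ = s
... | no _  | no _  = 1𝕀

level-mono : ∀ a b s {j k} → j ℕ.≤ k → level a b s j 𝕀ₚ.≤ level a b s k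
level-mono a b s {j} {k} j≤k with j ℕ.<? a | j ℕ.<? b | k ℕ.<? a | k ℕ.<? b
... | yes _  | _      | yes _  | _      = λ _ → id
... | yes _  | _      | no _   | yes _  = 0≤ s
... | yes _  | _      | no _   | no _   = 0≤ 1𝕀
... | no j≮a | _      | yes k<a | _     = contradiction (ℕ.≤-<-trans j≤k k<a) j≮a
... | no _   | yes _  | no _   | yes _  = λ _ → id
... | no _   | yes _  | no _   | no _   = ≤1 s
... | no _   | no j≮b | no _   | yes k<b = contradiction (ℕ.≤-<-trans j≤k k<b) j≮b
... | no _   | no _   | no _   | no _   = λ _ → id

-- The vectors `(0,…,0,s,…,s,1,…,1)`. With thresholds in `ℕ` rather than `Fin n`, the last block may
-- be empty and the induction on corners runs through all of `ℕ`.
step : ℕ → ℕ → 𝕀 → L n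
step a b s = record
  { π = λ j → level a b s (toℕ j) ; increasing = level-mono a b s }

step-≤ : ∀ a b s (x : L n) → (∀ j → a ℕ.≤ toℕ j → toℕ j ℕ.< b → s 𝕀ₚ.≤ π x j) →
         (∀ j → a ℕ.≤ toℕ j → b ℕ.≤ toℕ j → 1𝕀 𝕀ₚ.≤ π x j) → step a b s ≤ᴸ x
step-≤ a b s x s≤x 1≤x j with toℕ j ℕ.<? a | toℕ j ℕ.<? b
... | yes _  | _      = 0≤ (π x j)
... | no j≮a | yes j<b = s≤x j (ℕ.≮⇒≥ j≮a) j<b
... | no j≮a | no j≮b = 1≤x j (ℕ.≮⇒≥ j≮a) (ℕ.≮⇒≥ j≮b)

≤-step : ∀ a b s (x : L n) → (∀ j → toℕ j ℕ.< a → π x j 𝕀ₚ.≤ 0𝕀) →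
         (∀ j → a ℕ.≤ toℕ j → toℕ j ℕ.< b → π x j 𝕀ₚ.≤ s) → x ≤ᴸ step a b s
≤-step a b s x x≤0 x≤s j with toℕ j ℕ.<? a | toℕ j ℕ.<? b
... | yes j<a | _      = x≤0 j j<a
... | no j≮a | yes j<b = x≤s j (ℕ.≮⇒≥ j≮a) j<b
... | no _   | no _   = ≤1 (π x j)

level-0 : ∀ {a} b s {j} → j ℕ.< a → level a b s j ≡ 0𝕀
level-0 {a} b s {j} j<a with j ℕ.<? a | j ℕ.<? b
... | yes _  | _ = refl
... | no j≮a | _ = contradiction j<a j≮a

level-s : ∀ {a b} s {j} → a ℕ.≤ j → j ℕ.< b → level a b s j ≡ s
level-s {a} {b} s {j} a≤j j<b with j ℕ.<? a | j ℕ.<? b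
... | yes j<a | _    = contradiction a≤j (ℕ.<⇒≱ j<a)
... | no _ | yes _   = refl
... | no _ | no j≮b  = contradiction j<b j≮b

level-1 : ∀ {a b} s {j} → a ℕ.≤ j → b ℕ.≤ j → level a b s j ≡ 1𝕀
level-1 {a} {b} s {j} a≤j b≤j with j ℕ.<? a | j ℕ.<? b
... | yes j<a | _       = contradiction a≤j (ℕ.<⇒≱ j<a)
... | no _    | yes j<b = contradiction b≤j (ℕ.<⇒≱ j<b)
... | no _    | no _    = refl

≡⇒≤ : ∀ {x y : 𝕀} → x ≡ y → x 𝕀ₚ.≤ y
≡⇒≤ refl _ = id

infixr 9 _⨟_

_⨟_ : {P Q R : Fin n → ℚ → Set} →
      (∀ i q → P i q → Q i q) → (∀ i q → Q i q → R i q) → ∀ i q → P i q → R i q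
(f ⨟ g) i = f i ⨾ g i

≈⇒≤ : {P Q : Fin n → ℚ → Set} →
      (∀ i → (∀ q → P i q → Q i q) × (∀ q → Q i q → P i q)) → ∀ i q → P i q → Q i q
≈⇒≤ P≈Q i = proj₁ (P≈Q i)

≈⇒≥ : {P Q : Fin n → ℚ → Set} →
      (∀ i → (∀ q → P i q → Q i q) × (∀ q → Q i q → P i q)) → ∀ i q → Q i q → P i q
≈⇒≥ P≈Q i = proj₂ (P≈Q i)

corner : ℕ → L n
corner k = step k k 0𝕀

corner-low : ∀ {k} (j : Fin n) → toℕ j ℕ.< k → π {n} (corner k) j 𝕀ₚ.≤ 0𝕀
corner-low {k = k} j j<k = ≡⇒≤ (level-0 k 0𝕀 j<k)

corner-high : ∀ {k} (j : Fin n) → k ℕ.≤ toℕ j → 1𝕀 𝕀ₚ.≤ π {n} (corner k) j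
corner-high {k = k} j k≤j = ≡⇒≤ (sym (level-1 0𝕀 k≤j k≤j))

≤-corner : ∀ k (x : L n) → (∀ j → toℕ j ℕ.< k → π x j 𝕀ₚ.≤ 0𝕀) → x ≤ᴸ corner k
≤-corner k x x≤0 = ≤-step k k 0𝕀 x x≤0 λ j k≤j j<k → contradiction k≤j (ℕ.<⇒≱ j<k)

corner-≤ : ∀ k (x : L n) → (∀ j → k ℕ.≤ toℕ j → 1𝕀 𝕀ₚ.≤ π x j) → corner k ≤ᴸ x
corner-≤ k x 1≤x = step-≤ k k 0𝕀 x (λ j k≤j j<k → contradiction k≤j (ℕ.<⇒≱ j<k))
  λ j k≤j _ → 1≤x j k≤j

corner-antitone : ∀ k → corner {n} (suc k) ≤ᴸ corner k
corner-antitone k = corner-≤ (suc k) (corner k) λ j k<j → corner-high j (ℕ.<⇒≤ k<j)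

≤-corner-0 : (x : L n) → x ≤ᴸ corner 0
≤-corner-0 x = ≤-corner 0 x λ _ ()

-- Order automorphisms fix the corners.

LIso : ℕ → Set₁
LIso n = OrderIso (L-poset n)

open OrderIso

-- The upper bound for `to` thus comes from the lower bound for its inverse, and `corner-≤-to`,
-- quantified over all isomorphisms, covers both.
to-corner-≤-from : (I : LIso n) → ∀ k →
                   corner k ≤ᴸ from I (corner k) → to I (corner k) ≤ᴸ corner k
to-corner-≤-from I k c≤ = to-mono I (corner k) (from I (corner k)) c≤ ⨟ ≈⇒≤ (to-from I (corner k))

-- The interval from corner (k + 1) to corner k is a chain, as only coordinate k varies in it.
-- If A is an automorphism and A (corner (k + 1)) is not above corner (k + 1), then there are
-- incomparable y and z between A (corner (k + 1)) and A (corner k) = corner k.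
corner-≤-to : (I : LIso n) → ∀ k → corner k ≤ᴸ to I (corner k)
corner-≤-to I zero =
  ≈⇒≥ (to-from I (corner 0))
  ⨟ to-mono I (from I (corner 0)) (corner 0) (≤-corner-0 (from I (corner 0)))
corner-≤-to {n} I (suc k) = corner-≤ (suc k) x 1≤x
  where
  x : L n
  x = to I (corner (suc k))

  x≤corner : x ≤ᴸ corner k
  x≤corner = to-mono I (corner (suc k)) (corner k) (corner-antitone k)
    ⨟ to-corner-≤-from I k (corner-≤-to (flip I) k)

  module _ (j : Fin n) (k<j : k ℕ.< toℕ j) where
    i : Fin n
    i = fromℕ< (ℕ.<-trans k<j (toℕ<n j))

    i≡k : toℕ i ≡ k
    i≡k = toℕ-fromℕ< _

    -- `from y ≤ corner k` settles the coordinates below `k`, and `corner (suc k) ≤ from z` those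
    -- above, which leaves coordinate `i`.
    comparable : ∀ y z → x ≤ᴸ z → y ≤ᴸ corner k → z ≤ᴸ corner k →
                 π (from I y) i 𝕀ₚ.≤ π (from I z) i → y ≤ᴸ z
    comparable y z x≤z y≤c z≤c yᵢ≤zᵢ =
      ≈⇒≥ (to-from I y) ⨟ to-mono I (from I y) (from I z) from≤ ⨟ ≈⇒≤ (to-from I z)
      where
      from≤ : from I y ≤ᴸ from I z
      from≤ l with ℕ.<-cmp (toℕ l) k
      ... | tri< l<k _ _ = (from-mono I y (corner k) y≤c
              ⨟ to-corner-≤-from (flip I) k (corner-≤-to I k)) l
              ⨾ corner-low l l<k ⨾ 0≤ (π (from I z) l)
      ... | tri≈ _ l≡k _ = subst (λ l → π (from I y) l 𝕀ₚ.≤ π (from I z) l)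
              (toℕ-injective (trans i≡k (sym l≡k))) yᵢ≤zᵢ
      ... | tri> _ _ k<l = ≤1 (π (from I y) l) ⨾ corner-high l k<l
              ⨾ (≈⇒≥ (from-to I (corner (suc k))) ⨟ from-mono I x z x≤z) l

    incomparable⇒⊥ : ∀ y z → x ≤ᴸ y → x ≤ᴸ z → y ≤ᴸ corner k → z ≤ᴸ corner k →
                   ¬ y ≤ᴸ z → ¬ z ≤ᴸ y → ⊥
    incomparable⇒⊥ y z x≤y x≤z y≤c z≤c y≰z z≰y =
      z≰y (comparable z y x≤y z≤c y≤c
        (≰⇒≥ᵣ (value (π (from I y) i)) (value (π (from I z) i))
          λ yᵢ≤zᵢ → y≰z (comparable y z x≤z y≤c z≤c yᵢ≤zᵢ)))

    step-≤-corner : ∀ b s → step {n} k b s ≤ᴸ corner k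
    step-≤-corner b s = ≤-corner k (step k b s) λ l l<k → ≡⇒≤ (level-0 b s l<k)

    x≤step : ∀ b s → b ℕ.≤ suc (toℕ j) → π x j 𝕀ₚ.≤ s → x ≤ᴸ step k b s
    x≤step b s b≤ xⱼ≤s = ≤-step k b s x (λ l l<k → x≤corner l ⨾ corner-low l l<k)
      λ l _ l<b → increasing x (ℕ.≤-pred (ℕ.≤-trans l<b b≤)) ⨾ xⱼ≤s

    k≤i : k ℕ.≤ toℕ i
    k≤i = ℕ.≤-reflexive (sym i≡k)

    i< : ∀ {b} → k ℕ.< b → toℕ i ℕ.< b
    i< k<b = subst (ℕ._< _) (sym i≡k) k<b

    1≤x : 1𝕀 𝕀ₚ.≤ π x j
    1≤x q q<1 =
      let s , q<s , s<1 = between q<1 ; t , s<t , t<1 = between s<1 in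
      [ id , (λ u → ⊥-elim (absurd u s<t t<1)) ]′ (located (value (π x j)) q<s)
      where
      -- Here `π x j < t < 1`; `y` has `t` at positions `k` to `j`, while `z` has `π x j` at `k` and
      -- 1 after it. So `y` exceeds `z` at `k`, and `z` exceeds `y` at `j`.
      absurd : ∀ {s t} → upper (value (π x j)) s → s < t → t < 1ℚ → ⊥
      absurd {s} {t} u s<t t<1 = incomparable⇒⊥ y z
        (x≤step (suc (toℕ j)) ρ ℕ.≤-refl xⱼ≤ρ)
        (x≤step (suc k) (π x j) (s≤s (ℕ.<⇒≤ k<j)) (λ _ → id))
        (step-≤-corner _ _) (step-≤-corner _ _)
        (λ y≤z → disjoint (value (π x j))
          ((≡⇒≤ (sym (level-s ρ k≤i (i< (s≤s (ℕ.<⇒≤ k<j)))))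
            ⨾ y≤z i ⨾ ≡⇒≤ (level-s (π x j) k≤i (i< ℕ.≤-refl))) s s<t) u)
        (λ z≤y → <-irrefl refl
          ((≡⇒≤ (sym (level-1 (π x j) (ℕ.<⇒≤ k<j) k<j))
            ⨾ z≤y j ⨾ ≡⇒≤ (level-s ρ (ℕ.<⇒≤ k<j) ℕ.≤-refl)) t t<1))
        where
        ρ : 𝕀
        ρ = rational t
          (<⇒≤ (<-trans (≤ᵣ⇒upper 0ᵣ (value (π x j)) (0≤ (π x j)) s u) s<t)) (<⇒≤ t<1)

        xⱼ≤ρ : π x j 𝕀ₚ.≤ ρ
        xⱼ≤ρ = <⇒≤ᵣ (value (π x j)) (value ρ) u s<t

        y z : L n
        y = step k (suc (toℕ j)) ρ
        z = step k (suc k) (π x j)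

to-corner-≤ : (I : LIso n) → ∀ k → to I (corner k) ≤ᴸ corner k
to-corner-≤ I k = to-corner-≤-from I k (corner-≤-to (flip I) k)

-- Automorphisms act coordinatewise.

diagonal : LIso n → Fin n → 𝕀 → 𝕀
diagonal I i t = π (to I / t /) i

diagonal-mono : (I : LIso n) → ∀ i s t → s 𝕀ₚ.≤ t → diagonal I i s 𝕀ₚ.≤ diagonal I i t
diagonal-mono I i s t s≤t = to-mono I / s / / t / (λ _ → s≤t) i

-- step i n t is the meet of / t / and corner i, and step 0 (i + 1) t the join of / t / and
-- corner (i + 1).
diagonal-≤-step : (I : LIso n) → ∀ i t →
                  diagonal I i t 𝕀ₚ.≤ π (to I (step (toℕ i) n t)) i
diagonal-≤-step {n} I i t =
  ≡⇒≤ (sym (level-s s ℕ.≤-refl (toℕ<n i)))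
  ⨾ (≈⇒≥ (to-from I e) ⨟ to-mono I (from I e) (step k n t) from≤) i
  where
  k = toℕ i
  s = diagonal I i t
  -- As `e` is below `to I / t /` and `corner k`, its preimage is below `/ t /` and `corner k`,
  -- hence below their meet.
  e : L n
  e = step k n s

  e≤to : e ≤ᴸ to I / t /
  e≤to = step-≤ k n s (to I / t /) (λ j i≤j _ → increasing (to I / t /) i≤j)
    λ j _ n≤j → contradiction n≤j (ℕ.<⇒≱ (toℕ<n j))

  e≤corner : e ≤ᴸ corner k
  e≤corner = ≤-corner k e λ j j<k → ≡⇒≤ (level-0 n s j<k)

  from≤ : from I e ≤ᴸ step k n t
  from≤ = ≤-step k n t (from I e)
    (λ j j<k → (from-mono I e (corner k) e≤corner ⨟ to-corner-≤ (flip I) k) j ⨾ corner-low j j<k)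
    (λ j _ _ → (from-mono I e (to I / t /) e≤to ⨟ ≈⇒≤ (from-to I / t /)) j)

step-≤-diagonal : (I : LIso n) → ∀ i t →
                  π (to I (step 0 (suc (toℕ i)) t)) i 𝕀ₚ.≤ diagonal I i t
step-≤-diagonal {n} I i t =
  (to-mono I (step 0 (suc k) t) (from I e) ≤from ⨟ ≈⇒≤ (to-from I e)) i
  ⨾ ≡⇒≤ (level-s {0} {suc k} s {k} z≤n ℕ.≤-refl)
  where
  k = toℕ i
  s = diagonal I i t
  e : L n
  e = step 0 (suc k) s

  to≤e : to I / t / ≤ᴸ e
  to≤e = ≤-step 0 (suc k) s (to I / t /) (λ j ())
    λ j _ j≤i → increasing (to I / t /) (ℕ.≤-pred j≤i)

  corner≤e : corner (suc k) ≤ᴸ e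
  corner≤e = corner-≤ (suc k) e λ j k<j → ≡⇒≤ (sym (level-1 s z≤n k<j))

  ≤from : step 0 (suc k) t ≤ᴸ from I e
  ≤from = step-≤ 0 (suc k) t (from I e)
    (λ j _ _ → (≈⇒≥ (from-to I / t /) ⨟ from-mono I (to I / t /) e to≤e) j)
    (λ j _ k<j → corner-high j k<j
      ⨾ (corner-≤-to (flip I) (suc k) ⨟ from-mono I (corner (suc k)) e corner≤e) j)

-- As `x` is increasing, it lies below `step 0 (suc i) (π x i)` and above `step i n (π x i)`. This
-- and `diagonal-≤-to` show that coordinate `i` of the image depends on `π x i` alone.
to-≤-diagonal : (I : LIso n) → ∀ x i → π (to I x) i 𝕀ₚ.≤ diagonal I i (π x i)
to-≤-diagonal I x i = to-mono I x (step 0 (suc (toℕ i)) (π x i))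
  (≤-step 0 (suc (toℕ i)) (π x i) x (λ j ()) λ j _ j≤i → increasing x (ℕ.≤-pred j≤i)) i
  ⨾ step-≤-diagonal I i (π x i)

diagonal-≤-to : (I : LIso n) → ∀ x i → diagonal I i (π x i) 𝕀ₚ.≤ π (to I x) i
diagonal-≤-to {n} I x i = diagonal-≤-step I i (π x i) ⨾ to-mono I (step (toℕ i) n (π x i)) x
  (step-≤ (toℕ i) n (π x i) x (λ j i≤j _ → increasing x i≤j)
    λ j _ n≤j → contradiction n≤j (ℕ.<⇒≱ (toℕ<n j))) i

diagonal-inverse : (I : LIso n) → ∀ i t → diagonal I i (diagonal (flip I) i t) 𝕀ₚ.≈ t
diagonal-inverse I i t =
    (diagonal-≤-to I (from I / t /) i ⨾ ≈⇒≤ (to-from I / t /) i)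
  , (≈⇒≥ (to-from I / t /) i ⨾ to-≤-diagonal I (from I / t /) i)

diagonalIso : LIso n → Fin n → OrderIso 𝕀-poset
diagonalIso I i = record
  { to = diagonal I i ; from = diagonal (flip I) i
  ; to-mono = diagonal-mono I i ; from-mono = diagonal-mono (flip I) i
  ; to-from = diagonal-inverse I i ; from-to = diagonal-inverse (flip I) i }

-- The converse inequality holds because `to I / t /` is increasing; this one uses the same fact
-- about the inverse. So one map moves all coordinates, and `ψ` can compare roots at different ones.
diagonal-antitone : (I : LIso n) → ∀ {i j} → i Fin.≤ j → ∀ t → diagonal I j t 𝕀ₚ.≤ diagonal I i t
diagonal-antitone I {i} {j} i≤j t =
  diagonal-mono I j t (diagonal (flip I) j s)
    (proj₂ (diagonal-inverse (flip I) i t) ⨾ increasing (from I / s /) i≤j)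
  ⨾ proj₁ (diagonal-inverse I j s)
  where
  s : 𝕀
  s = diagonal I i t

-- The averaged automorphism.

module Averaging (I : LIso n) where
  -- Defined from `to I x`, so that the order of the coordinates is immediate; the coordinatewise
  -- form `F` serves to reflect the order and to invert.
  φ : L n → L n
  φ x = record
    { π = λ i → avg (π x i) (π (to I x) i)
    ; increasing = λ {i} {j} i≤j →
        avgᵣ-mono (value (π x i)) (value (π x j)) (value (π (to I x) i)) (value (π (to I x) j))
          (increasing x i≤j) (increasing (to I x) i≤j)
    }

  φ-mono : ∀ x y → x ≤ᴸ y → φ x ≤ᴸ φ y
  φ-mono x y x≤y i =
    avgᵣ-mono (value (π x i)) (value (π y i)) (value (π (to I x) i)) (value (π (to I y) i))
      (x≤y i) (to-mono I x y x≤y i)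

  F : Fin n → 𝕀 → 𝕀
  F i = avgWith (diagonal I i)

  φ≤F : ∀ x i → π (φ x) i 𝕀ₚ.≤ F i (π x i)
  φ≤F x i = avgᵣ-mono (value (π x i)) (value (π x i))
    (value (π (to I x) i)) (value (diagonal I i (π x i)))
    (λ _ → id) (to-≤-diagonal I x i)

  F≤φ : ∀ x i → F i (π x i) 𝕀ₚ.≤ π (φ x) i
  F≤φ x i = avgᵣ-mono (value (π x i)) (value (π x i))
    (value (diagonal I i (π x i))) (value (π (to I x) i))
    (λ _ → id) (diagonal-≤-to I x i)

  φ-reflects-≤ : ∀ x y → φ x ≤ᴸ φ y → x ≤ᴸ y
  φ-reflects-≤ x y φx≤φy i =
    avgWith-reflects-≤ (diagonal I i) (diagonal-mono I i) (π x i) (π y i)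
      (F≤φ x i ⨾ φx≤φy i ⨾ φ≤F y i)

  module Root (y : L n) (i : Fin n) = Solve (diagonalIso I i) (π y i)

  ψ : L n → L n
  ψ y = record
    { π = Root.root y
    ; increasing = λ {i} {j} i≤j →
        -- Both roots are compared under the same `F i`: `F i (root i) ≤ y i ≤ y j ≤ F j (root j) ≤
        -- F i (root j)`.
        avgWith-reflects-≤ (diagonal I i) (diagonal-mono I i) (Root.root y i) (Root.root y j)
          (Root.avg≤c y i ⨾ increasing y i≤j ⨾ Root.c≤avg y j
          ⨾ avgᵣ-mono (value (Root.root y j)) (value (Root.root y j))
              (value (diagonal I j (Root.root y j))) (value (diagonal I i (Root.root y j)))
              (λ _ → id) (diagonal-antitone I i≤j (Root.root y j)))
    }

  φψ : ∀ y → φ (ψ y) ≈ᴸ y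
  φψ y i = (φ≤F (ψ y) i ⨾ Root.avg≤c y i) , (Root.c≤avg y i ⨾ F≤φ (ψ y) i)

  automorphism : Automorphism n
  automorphism = record
    { bijection = record
      { to = φ
      ; cong = λ {x} {y} → φ-cong x y
      ; bijective = (λ {x} {y} φx≈φy i →
            φ-reflects-≤ x y (≈⇒≤ φx≈φy) i , φ-reflects-≤ y x (≈⇒≥ φx≈φy) i)
        , λ y → ψ y , λ {z} z≈ψy i → (proj₁ (φ-cong z (ψ y) z≈ψy i) ⨾ proj₁ (φψ y i))
                                 , (proj₂ (φψ y i) ⨾ proj₂ (φ-cong z (ψ y) z≈ψy i))
      }
    ; order = λ x y → mk⇔ (φ-mono x y) (φ-reflects-≤ x y)
    }
    where
    φ-cong : ∀ x y → x ≈ᴸ y → φ x ≈ᴸ φ y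
    φ-cong x y x≈y i = φ-mono x y (≈⇒≤ x≈y) i , φ-mono y x (≈⇒≥ x≈y) i

-- Strong negations are conjugates of `N-S`.

N-S-antitone : (x y : L n) → x ≤ᴸ y → N-S ⟨$⟩ y ≤ᴸ N-S ⟨$⟩ x
N-S-antitone x y x≤y i = 1-‿antitone (π x (opposite i)) (π y (opposite i)) (x≤y (opposite i))

N-S-involutive : (x : L n) → N-S ⟨$⟩ (N-S ⟨$⟩ x) ≈ᴸ x
N-S-involutive x i = subst (λ j → 1- 1- π x j 𝕀ₚ.≈ π x i) (sym (opposite-involutive i))
  (1-‿involutive (π x i))

infixr 9 _≈⨟_

_≈⨟_ : {P Q R : Fin n → ℚ → Set} →
       (∀ i → (∀ q → P i q → Q i q) × (∀ q → Q i q → P i q)) →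
       (∀ i → (∀ q → Q i q → R i q) × (∀ q → R i q → Q i q)) →
       ∀ i → (∀ q → P i q → R i q) × (∀ q → R i q → P i q)
(p ≈⨟ r) i = (proj₁ (p i) ⨾ proj₁ (r i)) , (proj₂ (r i) ⨾ proj₂ (p i))

map-cong : (M : Map n) (x y : L n) → x ≈ᴸ y → M ⟨$⟩ x ≈ᴸ M ⟨$⟩ y
map-cong M x y = Func.cong M {x} {y}

module _ (N : Map n) (strong : IsStrongNegation N) where
  open IsStrongNegation strong
  open IsNegation isNegation

  negationIso : LIso n
  negationIso = record
    { to        = λ x → N-S ⟨$⟩ (N ⟨$⟩ x)
    ; from      = λ x → N ⟨$⟩ (N-S ⟨$⟩ x)
    ; to-mono   = λ x y x≤y → N-S-antitone (N ⟨$⟩ y) (N ⟨$⟩ x) (antitone x y x≤y)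
    ; from-mono = λ x y x≤y → antitone (N-S ⟨$⟩ y) (N-S ⟨$⟩ x) (N-S-antitone x y x≤y)
    ; to-from   = λ x →
        map-cong N-S (N ⟨$⟩ (N ⟨$⟩ (N-S ⟨$⟩ x))) (N-S ⟨$⟩ x) (involutive (N-S ⟨$⟩ x))
        ≈⨟ N-S-involutive x
    ; from-to   = λ x →
        map-cong N (N-S ⟨$⟩ (N-S ⟨$⟩ (N ⟨$⟩ x))) (N ⟨$⟩ x) (N-S-involutive (N ⟨$⟩ x))
        ≈⨟ involutive x
    }

  open Averaging negationIso

  -- Both sides average `N x` and `N-S x`: on the left the second term is `N-S (N (N x))`, on the
  -- right the terms are `N-S x` and `N-S (N-S (N x))`.
  φN≈N-Sφ : ∀ x → φ (N ⟨$⟩ x) ≈ᴸ N-S ⟨$⟩ φ x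
  φN≈N-Sφ x i =
      (avgᵣ-comm-≤ (value a) (value b)
       ⨾ avgᵣ-mono (value b) (value b′) (value a) (value a′) (proj₁ b≈b′) (proj₂ a′≈a)
       ⨾ proj₂ 1-avg′)
    , (proj₁ 1-avg′
       ⨾ avgᵣ-mono (value b′) (value b) (value a′) (value a) (proj₂ b≈b′) (proj₁ a′≈a)
       ⨾ avgᵣ-comm-≤ (value b) (value a))
    where
    a b a′ b′ : 𝕀
    a = π (N ⟨$⟩ x) i
    b = π (N-S ⟨$⟩ (N ⟨$⟩ (N ⟨$⟩ x))) i
    a′ = π (N-S ⟨$⟩ (N-S ⟨$⟩ (N ⟨$⟩ x))) i
    b′ = π (N-S ⟨$⟩ x) i

    1-avg′ : π (N-S ⟨$⟩ φ x) i 𝕀ₚ.≈ avg b′ a′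
    1-avg′ = 1-avg (π x (opposite i)) (π (N-S ⟨$⟩ (N ⟨$⟩ x)) (opposite i))

    a′≈a : a′ 𝕀ₚ.≈ a
    a′≈a = N-S-involutive (N ⟨$⟩ x) i

    b≈b′ : b 𝕀ₚ.≈ b′
    b≈b′ = map-cong N-S (N ⟨$⟩ (N ⟨$⟩ x)) x (involutive x) i

  strong⇒conjugate : ∀ x → N ⟨$⟩ x ≈ᴸ (N-S ^ automorphism) ⟨$⟩ x
  strong⇒conjugate x i =
      φ-reflects-≤ (N ⟨$⟩ x) y (≈⇒≤ φN≈φy) i
    , φ-reflects-≤ y (N ⟨$⟩ x) (≈⇒≥ φN≈φy) i
    where
    -- By computation this is the right-hand side, the inverse of `automorphism` being `ψ`; it is
    -- compared with `N x` under `φ`.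
    y : L n
    y = ψ (N-S ⟨$⟩ φ x)

    φN≈φy : φ (N ⟨$⟩ x) ≈ᴸ φ y
    φN≈φy i = (proj₁ (φN≈N-Sφ x i) ⨾ proj₂ (φψ (N-S ⟨$⟩ φ x) i))
            , (proj₁ (φψ (N-S ⟨$⟩ φ x) i) ⨾ proj₂ (φN≈N-Sφ x i))

-- Conjugates of `N-S` are strong negations.

antitone∧involutive⇒strong : (N : Map n) → (∀ x y → x ≤ᴸ y → N ⟨$⟩ y ≤ᴸ N ⟨$⟩ x) →
                             (∀ x → N ⟨$⟩ (N ⟨$⟩ x) ≈ᴸ x) → IsStrongNegation N
antitone∧involutive⇒strong N antitone involutive = record
  { isNegation = record
    -- `/ 0𝕀 / ≤ N / 1𝕀 /` gives `/ 1𝕀 / = N (N / 1𝕀 /) ≤ N / 0𝕀 /`; the value at `/ 1𝕀 /` is dual.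
    { N/0/ = λ i → ≤1 (π (N ⟨$⟩ / 0𝕀 /) i)
        , (≈⇒≥ (involutive / 1𝕀 /)
           ⨟ antitone / 0𝕀 / (N ⟨$⟩ / 1𝕀 /) (λ j → 0≤ (π (N ⟨$⟩ / 1𝕀 /) j))) i
    ; N/1/ = λ i →
        (antitone (N ⟨$⟩ / 0𝕀 /) / 1𝕀 / (λ j → ≤1 (π (N ⟨$⟩ / 0𝕀 /) j))
          ⨟ ≈⇒≤ (involutive / 0𝕀 /)) i
        , 0≤ (π (N ⟨$⟩ / 1𝕀 /) i)
    ; antitone = antitone
    }
  ; involutive = involutive
  }

module _ (φ : Automorphism n) where
  open Automorphism φ

  f g M : L n → L n
  f x = function ⟨$⟩ x
  g x = inverse ⟨$⟩ x
  M x = (N-S ^ φ) ⟨$⟩ x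

  f-mono : ∀ x y → x ≤ᴸ y → f x ≤ᴸ f y
  f-mono x y = Equivalence.to (order x y)

  f-reflects-≤ : ∀ x y → f x ≤ᴸ f y → x ≤ᴸ y
  f-reflects-≤ x y = Equivalence.from (order x y)

  fg : ∀ y → f (g y) ≈ᴸ y
  fg y = proj₂ (Bijection.surjective bijection y) {g y} λ i → (λ _ → id) , (λ _ → id)

  -- Since `f` also reflects the order, the properties of `N-S` pass to `M` through this.
  fM : ∀ x → f (M x) ≈ᴸ N-S ⟨$⟩ f x
  fM x = fg (N-S ⟨$⟩ f x)

  M-antitone : ∀ x y → x ≤ᴸ y → M y ≤ᴸ M x
  M-antitone x y x≤y = f-reflects-≤ (M y) (M x)
    (≈⇒≤ (fM y) ⨟ N-S-antitone (f x) (f y) (f-mono x y x≤y) ⨟ ≈⇒≥ (fM x))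

  M-involutive : ∀ x → M (M x) ≈ᴸ x
  M-involutive x i = f-reflects-≤ (M (M x)) x (≈⇒≤ fMM≈f) i , f-reflects-≤ x (M (M x)) (≈⇒≥ fMM≈f) i
    where
    fMM≈f : f (M (M x)) ≈ᴸ f x
    fMM≈f = fM (M x) ≈⨟ map-cong N-S (f (M x)) (N-S ⟨$⟩ f x) (fM x) ≈⨟ N-S-involutive (f x)

  conjugate⇒strong : (N : Map n) → (∀ x → N ⟨$⟩ x ≈ᴸ M x) → IsStrongNegation N
  conjugate⇒strong N N≈M = antitone∧involutive⇒strong N
    (λ x y x≤y → ≈⇒≤ (N≈M y) ⨟ M-antitone x y x≤y ⨟ ≈⇒≥ (N≈M x))
    (λ x → N≈M (N ⟨$⟩ x) ≈⨟ map-cong (N-S ^ φ) (N ⟨$⟩ x) (M x) (N≈M x) ≈⨟ M-involutive x)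

theorem36 : (n : ℕ) → n ≥ 1 → (N : Map n) →
    IsStrongNegation N ⇔ (∃ λ (φ : Automorphism n) → ∀ x → N ⟨$⟩ x ≈ᴸ (N-S ^ φ) ⟨$⟩ x)
theorem36 n n≥1 N = mk⇔
  (λ strong → Averaging.automorphism (negationIso N strong) , strong⇒conjugate N strong)
  (λ (φ , N≈M) → conjugate⇒strong φ N N≈M)
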